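{- For every matroid $M$ and every integer $k\ge 1$, the coefficients of $\chi^k_M(t_1,\dots,t_k)$ alternate in sign by total degree; that is, if $c$ and $c'$ are nonzero coefficients in $\chi^k_M$ of monomials of total degrees $d$ and $d'$ respectively, then $c$ and $c'$ have the same sign if $d\equiv d' \pmod 2$ and opposite signs if $d\not\equiv d'\pmod 2$.
   Context: A matroid $M=(\mathcal{A},\mathrm{rk})$ is given by a finite ground set $\mathcal{A}$ and its rank function $\mathrm{rk}$; $\mathrm{rk}(M)=\mathrm{rk}(\mathcal{A})$. For $k\ge 1$ let $\mathcal{C}^k_{\mathcal{A}}=\{(A_1,\dots,A_k)\in(2^{\mathcal{A}})^k \mid A_1\subseteq A_2\subseteq\cdots\subseteq A_k\subseteq\mathcal{A}\}$ (inclusions need not be strict). The $k$th chain characteristic polynomial is $\chi_M^k(t_1,\dots,t_k)=\sum_{(A_i)\in\mathcal{C}^k_{\mathcal{A}}}\prod_{i=1}^k(-1)^{|A_i|}t_i^{\mathrm{rk}(M)-\mathrm{rk}(A_i)}$. The total degree of $t_1^{m_1}\cdots t_k^{m_k}$ is $m_1+\cdots+m_k$. -}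

module Defs where

open import Data.Bool using (Bool; true; false)
open import Data.Fin using (Fin)
open import Data.Fin.Subset using (Subset; _⊆_; _∪_; _∩_; ∣_∣; ⊤)
open import Data.Fin.Subset.Properties using (_⊆?_)
open import Data.Integer as ℤ using (ℤ; 0ℤ; 1ℤ; -1ℤ)
open import Data.List as List using (List; []; _∷_; _++_; [_]; filter; cartesianProductWith)
open import Data.Nat using (ℕ; zero; suc; _+_; _∸_; _≤_)
open import Data.Nat.Properties using () renaming (_≟_ to _≟ℕ_)
open import Data.Product using (_×_; _,_; proj₁; proj₂)
open import Data.Vec as Vec using (Vec; []; _∷_; lookup; zipWith; replicate; _[_]≔_)
open import Data.Vec.Functional as VecF using (Vector)
open import Data.Vec.Properties using (≡-dec)
open import Data.Vec.Relation.Unary.Linked using (linked?)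

record Matroid (n : ℕ) : Set where
  field
    rk            : Subset n → ℕ
    rk-bounded    : ∀ A → rk A ≤ ∣ A ∣
    rk-monotone   : ∀ A B → A ⊆ B → rk A ≤ rk B
    rk-submodular : ∀ A B → rk (A ∪ B) + rk (A ∩ B) ≤ rk A + rk B

  rank : ℕ
  rank = rk ⊤

-- Integer polynomials in k variables, as formal sums of terms c · t^m given by
-- pairs (c , m).  The same exponent vector may occur in several terms, and zero
-- coefficients are allowed, so a polynomial has many representations; its
-- coefficients are read off with coeff.
Poly : ℕ → Set
Poly k = List (ℤ × Vec ℕ k)

module _ {k : ℕ} where

  const : ℤ → Poly k
  const c = [ c , replicate k 0 ]

  var : Fin k → Poly k
  var i = [ 1ℤ , replicate k 0 [ i ]≔ 1 ]

  infixl 7 _⊗_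
  infixr 8 _⊗^_

  _⊗_ : Poly k → Poly k → Poly k
  _⊗_ = cartesianProductWith λ (c , m) (c′ , m′) → c ℤ.* c′ , zipWith _+_ m m′

  _⊗^_ : Poly k → ℕ → Poly k
  p ⊗^ zero  = const 1ℤ
  p ⊗^ suc e = p ⊗ p ⊗^ e

  -- Addition of formal sums is concatenation.
  ∑ : List (Poly k) → Poly k
  ∑ = List.foldr _++_ []

  ∏ : ∀ {l} → Vector (Poly k) l → Poly k
  ∏ = VecF.foldr _⊗_ (const 1ℤ)

  coeff : Poly k → Vec ℕ k → ℤ
  coeff p m = List.foldr ℤ._+_ 0ℤ
    (List.map proj₁ (filter (λ term → ≡-dec _≟ℕ_ (proj₂ term) m) p))

  totalDegree : Vec ℕ k → ℕ
  totalDegree = Vec.sum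

-- All vectors of length k with entries from the given list.
tuples : ∀ {A : Set} → List A → (k : ℕ) → List (Vec A k)
tuples xs zero    = [ [] ]
tuples xs (suc k) = cartesianProductWith _∷_ xs (tuples xs k)

-- Subset n is by definition a vector of n Booleans.
subsets : (n : ℕ) → List (Subset n)
subsets = tuples (false ∷ true ∷ [])

-- Every weakly increasing k-tuple of subsets, listed exactly once.
chains : (n k : ℕ) → List (Vec (Subset n) k)
chains n k = filter (linked? _⊆?_) (tuples (subsets n) k)

-- The truncated subtraction is exact, since rk is monotone.
χ : ∀ {n} → Matroid n → (k : ℕ) → Poly k
χ {n} M k = ∑ (List.map term (chains n k))
  where
  open Matroid M

  term : Vec (Subset n) k → Poly k
  term A = ∏ λ (i : Fin k) →
    const (-1ℤ ℤ.^ ∣ lookup A i ∣) ⊗ var i ⊗^ (rank ∸ rk (lookup A i))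

{-# OPTIONS --safe #-}

-- Put ε A = (-1)^(|A| + rk A).  Up to the global sign (-1)^(k rk M + deg m), the
-- coefficient of t^m is a k-fold nested sum Σ_{A₁} ε A₁ ⋯ Σ_{A_k ⊇ A_{k-1}} ε A_k over sets
-- of prescribed coranks, so it suffices that this sum is nonnegative.  Evaluate
-- it from the inside, as a function of the preceding set.  If f ≥ 0 depends only
-- on the closure, then Σ_{A ⊇ B} ε A f A has the sign ε B, and it vanishes unless B is a flat:
-- split on an element e ∉ B; if e lies in the closure of B then A ↔ A ∪ e cancels
-- all terms, and otherwise ε (B ∪ e) = ε B.  Conversely, if h ≥ 0 is supported on flats,
-- then Σ_{A ⊇ B} h A is nonnegative and depends only on the closure of B.  The two
-- situations alternate.
module Submission where

open import Defs
open import Data.Bool using (Bool; true; false; _∧_; if_then_else_)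
open import Data.Fin using (Fin; zero; suc)
open import Data.Fin.Subset using (Subset; _∈_; _⊆_; _∪_; _∩_; ∣_∣; ⊤; ⊥; ⁅_⁆)
open import Data.Fin.Subset.Properties
open import Data.Integer as ℤ
  using (ℤ; 0ℤ; 1ℤ; -1ℤ; sign; +_; -[1+_]; -_; _+_; _*_; _^_; +≤+)
import Data.Integer.Properties as ℤ
open import Data.List as List using (List; []; _∷_; _++_; [_]; filter; cartesianProductWith)
open import Data.Nat as ℕ using (ℕ; zero; suc; _≤_; _%_; _∸_; z≤n)
import Data.Nat.Properties as ℕ
import Data.Nat.Tactic.RingSolver as ℕ
open import Data.Product using (_×_; _,_; proj₁; proj₂)
open import Data.Sign as Sign using (opposite)
import Data.Sign.Properties as Sign
open import Data.Sum using (_⊎_; inj₁; inj₂)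
open import Data.Vec as Vec using (Vec; []; _∷_; lookup; _[_]≔_; here; there; replicate; zipWith)
import Data.Vec.Functional as VecF
open import Data.Vec.Properties using (≡-dec; lookup-map; zipWith-identityˡ; zipWith-replicate)
open import Data.Vec.Relation.Unary.Linked as Linked using (Linked; linked?; []; [-]; _∷_)
open import Function using (_∘_; mk⇔)
open import Relation.Binary.PropositionalEquality
  using (_≡_; _≢_; refl; sym; trans; cong; cong₂; subst; module ≡-Reasoning)
open import Relation.Nullary using (Dec; does; yes; no; contradiction)
open import Relation.Nullary.Decidable using (does-⇔)

private
  variable
    n : ℕ
    X Y Z : Set
    A B C D : Subset n
    f g h : Subset n → ℤ

-- Guarded terms and sums over supersets.

infixr 5 _▹_

-- An Iverson bracket on Booleans, so that guards coming from `does` reduce by computation.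
_▹_ : Bool → ℤ → ℤ
b ▹ x = if b then x else 0ℤ

▹-nonneg : ∀ b {x} → 0ℤ ℤ.≤ x → 0ℤ ℤ.≤ b ▹ x
▹-nonneg true  0≤x = 0≤x
▹-nonneg false 0≤x = ℤ.≤-refl

▹-zero : ∀ b → b ▹ 0ℤ ≡ 0ℤ
▹-zero true  = refl
▹-zero false = refl

*-▹-comm : ∀ b i x → i * (b ▹ x) ≡ b ▹ (i * x)
*-▹-comm true  i x = refl
*-▹-comm false i x = ℤ.*-zeroʳ i

-- Recursion on the ground set rather than a filtered list: an element of `B` is contracted, any
-- other splits the sum into deletion and contraction, as the inductions below require.
Σ⊇ : Subset n → (Subset n → ℤ) → ℤ
Σ⊇ []          f = f []
Σ⊇ (true  ∷ B) f = Σ⊇ B (f ∘ (true ∷_))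
Σ⊇ (false ∷ B) f = Σ⊇ B (f ∘ (false ∷_)) + Σ⊇ B (f ∘ (true ∷_))

Σ⊇-nonneg : ∀ (B : Subset n) → (∀ A → 0ℤ ℤ.≤ f A) → 0ℤ ℤ.≤ Σ⊇ B f
Σ⊇-nonneg []          0≤f = 0≤f []
Σ⊇-nonneg (true  ∷ B) 0≤f = Σ⊇-nonneg B (0≤f ∘ (true ∷_))
Σ⊇-nonneg (false ∷ B) 0≤f =
  ℤ.+-mono-≤ (Σ⊇-nonneg B (0≤f ∘ (false ∷_))) (Σ⊇-nonneg B (0≤f ∘ (true ∷_)))

-- The equation is asked only above `B`, because in `tied-cancel` it comes from a tie at `B` and is
-- available only there.
Σ⊇-* : ∀ i (B : Subset n) → (∀ A → B ⊆ A → g A ≡ i * f A) → Σ⊇ B g ≡ i * Σ⊇ B f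
Σ⊇-* i []          eq = eq [] (λ ())
Σ⊇-* i (true  ∷ B) eq = Σ⊇-* i B λ A B⊆A → eq (true ∷ A) (s⊆s B⊆A)
Σ⊇-* i (false ∷ B) eq =
  trans (cong₂ _+_ (Σ⊇-* i B λ A B⊆A → eq (false ∷ A) (out⊆ B⊆A))
                   (Σ⊇-* i B λ A B⊆A → eq (true ∷ A) (out⊆ B⊆A)))
        (sym (ℤ.*-distribˡ-+ i _ _))

-- Signed sums over supersets: cancellation, sign and vanishing.

-- The model of ε is (-1)^(|A| + ρ A), which satisfies flip and keep because ρ grows
-- by at most one per element.  Since ρ ∅ = 0 is not required, fixing one coordinate
-- (deletion or contraction) needs no normalisation.
record IsSignedRank (ρ : Subset n → ℕ) (ε : Subset n → ℤ) : Set where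
  field
    mono       : ∀ A B → A ⊆ B → ρ A ≤ ρ B
    submodular : ∀ A B → ρ (A ∪ B) ℕ.+ ρ (A ∩ B) ≤ ρ A ℕ.+ ρ B
    flip       : ∀ A i → lookup A i ≡ false →
                 ρ (A [ i ]≔ true) ≡ ρ A → ε (A [ i ]≔ true) ≡ - ε A
    keep       : ∀ A i → lookup A i ≡ false →
                 ρ (A [ i ]≔ true) ≢ ρ A → ε (A [ i ]≔ true) ≡ ε A

  -- Closure is monotone: if `D` lies in the closure of `C`, it lies in that of every `B` above `C`.
  -- Submodularity for `B` and `D` gives this, since `B ∩ D` contains `C` and so has rank at least
  -- `ρ D`.
  absorb : C ⊆ D → ρ C ≡ ρ D → C ⊆ B → ρ (B ∪ D) ≡ ρ B
  absorb {C = C} {D} {B} C⊆D ρC≡ρD C⊆B = ℕ.≤-antisym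
    (ℕ.+-cancelʳ-≤ (ρ D) _ _ (begin
      ρ (B ∪ D) ℕ.+ ρ D       ≡⟨ cong (ρ (B ∪ D) ℕ.+_) ρC≡ρD ⟨
      ρ (B ∪ D) ℕ.+ ρ C       ≤⟨ ℕ.+-monoʳ-≤ (ρ (B ∪ D))
                                   (mono C (B ∩ D) λ x∈C → x∈p∩q⁺ (C⊆B x∈C , C⊆D x∈C)) ⟩
      ρ (B ∪ D) ℕ.+ ρ (B ∩ D) ≤⟨ submodular B D ⟩
      ρ B ℕ.+ ρ D             ∎))
    (mono B (B ∪ D) (p⊆p∪q D))
    where open ℕ.≤-Reasoning

restrict : ∀ {ρ : Subset (suc n) → ℕ} {ε} b → IsSignedRank ρ ε →
           IsSignedRank (ρ ∘ (b ∷_)) (ε ∘ (b ∷_))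
restrict {ρ = ρ} b S = record
  { mono       = λ A B A⊆B → mono (b ∷ A) (b ∷ B) (s⊆s A⊆B)
  ; submodular = sub b
  ; flip       = λ A i → flip (b ∷ A) (suc i)
  ; keep       = λ A i → keep (b ∷ A) (suc i)
  }
  where
  open IsSignedRank S
  sub : ∀ b A B → ρ (b ∷ A ∪ B) ℕ.+ ρ (b ∷ A ∩ B) ≤ ρ (b ∷ A) ℕ.+ ρ (b ∷ B)
  sub false A B = submodular (false ∷ A) (false ∷ B)
  sub true  A B = submodular (true ∷ A) (true ∷ B)

-- A ⊆ B and ρ A = ρ B say that B lies in the closure of A.
ClosureInvariant : (Subset n → ℕ) → (Subset n → ℤ) → Set
ClosureInvariant ρ f = ∀ {A B} → A ⊆ B → ρ A ≡ ρ B → f A ≡ f B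

VanishesOffFlats : (Subset n → ℕ) → (Subset n → ℤ) → Set
VanishesOffFlats ρ h = ∀ {A B} → A ⊆ B → ρ A ≡ ρ B → A ≢ B → h A ≡ 0ℤ

-- The instance of `absorb` for one element: if the first element is in the closure of `B`, it is in
-- the closure of each larger `A`.
tied : ∀ {ρ : Subset (suc n) → ℕ} {ε} → IsSignedRank ρ ε → B ⊆ A →
       ρ (false ∷ B) ≡ ρ (true ∷ B) → ρ (false ∷ A) ≡ ρ (true ∷ A)
tied {A = A} S B⊆A eq = ℕ.≤-antisym (mono _ _ (out⊆ λ x → x))
  (ℕ.≤-trans (mono (true ∷ A) (true ∷ A ∪ _) (s⊆s (p⊆p∪q _)))
    (ℕ.≤-reflexive (absorb {B = false ∷ A} (out⊆ λ x → x) eq (s⊆s B⊆A))))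
  where open IsSignedRank S

-- Pair `false ∷ A` with `true ∷ A`. By `tied` they have equal rank, so `f` agrees on them while `ε`
-- changes sign.
tied-cancel : ∀ {ρ : Subset (suc n) → ℕ} {ε} → IsSignedRank ρ ε →
  {f : Subset (suc n) → ℤ} → ClosureInvariant ρ f →
  ∀ (B : Subset n) → ρ (false ∷ B) ≡ ρ (true ∷ B) →
  Σ⊇ (false ∷ B) (λ A → ε A * f A) ≡ 0ℤ
tied-cancel {ε = ε} S {f} inv B eq =
  begin
    Σ₀ + Σ⊇ B (λ A → ε (true ∷ A) * f (true ∷ A)) ≡⟨ cong (_+_ Σ₀) (Σ⊇-* -1ℤ B opposite-terms) ⟩
    Σ₀ + -1ℤ * Σ₀                                 ≡⟨ cong (_+_ Σ₀) (ℤ.-1*i≡-i Σ₀) ⟩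
    Σ₀ + - Σ₀                                     ≡⟨ ℤ.+-inverseʳ Σ₀ ⟩
    0ℤ                                            ∎
  where
  open IsSignedRank S
  open ≡-Reasoning
  Σ₀ = Σ⊇ B (λ A → ε (false ∷ A) * f (false ∷ A))
  opposite-terms : ∀ A → B ⊆ A →
    ε (true ∷ A) * f (true ∷ A) ≡ -1ℤ * (ε (false ∷ A) * f (false ∷ A))
  opposite-terms A B⊆A = begin
    ε (true ∷ A) * f (true ∷ A)
      ≡⟨ cong₂ _*_ (flip (false ∷ A) zero refl (sym (tied S B⊆A eq)))
                   (sym (inv (out⊆ λ x → x) (tied S B⊆A eq))) ⟩
    - ε (false ∷ A) * f (false ∷ A)
      ≡⟨ ℤ.neg-distribˡ-* (ε (false ∷ A)) _ ⟨
    - (ε (false ∷ A) * f (false ∷ A))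
      ≡⟨ ℤ.-1*i≡-i (ε (false ∷ A) * f (false ∷ A)) ⟨
    -1ℤ * (ε (false ∷ A) * f (false ∷ A)) ∎

-- For the empty ground set, where `ε []` may be any integer: `IsSignedRank` fixes only how `ε`
-- changes, not its values.
0≤i*[i*j] : ∀ i {j} → 0ℤ ℤ.≤ j → 0ℤ ℤ.≤ i * (i * j)
0≤i*[i*j] i {+ j} _ rewrite sym (ℤ.*-assoc i i (+ j)) = sq i
  where
  sq : ∀ i → 0ℤ ℤ.≤ i * i * + j
  sq (+ i)    rewrite ℤ.+◃n≡+n (i ℕ.* i) | ℤ.+◃n≡+n (i ℕ.* i ℕ.* j) = +≤+ z≤n
  sq -[1+ i ] rewrite ℤ.+◃n≡+n (suc i ℕ.* suc i ℕ.* j) = +≤+ z≤n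

-- The factor `ε B` encodes that the sum is zero or has the sign of `ε B`. Induct on the ground set:
-- a first element outside `B` is either tied, and everything cancels, or `keep` gives both halves
-- the same sign.
signedSum-nonneg : ∀ {ρ : Subset n → ℕ} {ε} → IsSignedRank ρ ε →
  {f : Subset n → ℤ} → ClosureInvariant ρ f → (∀ A → 0ℤ ℤ.≤ f A) →
  ∀ B → 0ℤ ℤ.≤ ε B * Σ⊇ B (λ A → ε A * f A)
signedSum-nonneg {ε = ε} S inv 0≤f []          = 0≤i*[i*j] (ε []) (0≤f [])
signedSum-nonneg S inv 0≤f (true  ∷ B) =
  signedSum-nonneg (restrict true S) (inv ∘ s⊆s) (0≤f ∘ (true ∷_)) B
signedSum-nonneg {ρ = ρ} {ε} S {f} inv 0≤f (false ∷ B)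
  with ρ (true ∷ B) ℕ.≟ ρ (false ∷ B)
... | yes eq rewrite tied-cancel S inv B (sym eq) | ℤ.*-zeroʳ (ε (false ∷ B)) = ℤ.≤-refl
... | no neq = begin
  0ℤ                                      ≤⟨ ℤ.+-mono-≤ (half false) (half true) ⟩
  ε (false ∷ B) * S₀ + ε (true ∷ B) * S₁  ≡⟨ cong (λ x → ε (false ∷ B) * S₀ + x * S₁)
                                               (keep (false ∷ B) zero refl neq) ⟩
  ε (false ∷ B) * S₀ + ε (false ∷ B) * S₁ ≡⟨ ℤ.*-distribˡ-+ (ε (false ∷ B)) S₀ S₁ ⟨
  ε (false ∷ B) * (S₀ + S₁)               ∎
  where
  open IsSignedRank S
  open ℤ.≤-Reasoning
  S₀ = Σ⊇ B (λ A → ε (false ∷ A) * f (false ∷ A))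
  S₁ = Σ⊇ B (λ A → ε (true ∷ A) * f (true ∷ A))
  half : ∀ b → 0ℤ ℤ.≤ ε (b ∷ B) * Σ⊇ B (λ A → ε (b ∷ A) * f (b ∷ A))
  half b = signedSum-nonneg (restrict b S) (inv ∘ s⊆s) (0≤f ∘ (b ∷_)) B

-- The recursion descends to the first element of the larger set missing from the smaller. There the
-- equal ranks squeeze the rank with that element added, so `tied-cancel` applies.
signedSum-vanishes : ∀ {ρ : Subset n → ℕ} {ε} → IsSignedRank ρ ε →
  {f : Subset n → ℤ} → ClosureInvariant ρ f →
  VanishesOffFlats ρ (λ B → Σ⊇ B (λ A → ε A * f A))
signedSum-vanishes S inv {[]} {[]} _ _ ≢ = contradiction refl ≢
signedSum-vanishes S inv {true ∷ B} {false ∷ B′} B⊆B′ _ _ with () ← B⊆B′ {zero} here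
signedSum-vanishes S inv {true ∷ B} {true ∷ B′} B⊆B′ eq ≢ =
  signedSum-vanishes (restrict true S) (inv ∘ s⊆s) (drop-∷-⊆ B⊆B′) eq (≢ ∘ cong (true ∷_))
signedSum-vanishes S inv {false ∷ B} {true ∷ B′} B⊆B′ eq ≢ =
  tied-cancel S inv B (ℕ.≤-antisym (mono _ _ (out⊆ λ x → x))
    (ℕ.≤-trans (mono _ _ (s⊆s (drop-∷-⊆ B⊆B′))) (ℕ.≤-reflexive (sym eq))))
  where open IsSignedRank S
signedSum-vanishes S inv {false ∷ B} {false ∷ B′} B⊆B′ eq ≢ =
  cong₂ _+_
    (signedSum-vanishes (restrict false S) (inv ∘ s⊆s) B⊆′ eq (≢ ∘ cong (false ∷_)))
    -- After contraction the larger set must still lie in the closure of the smaller one, which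
    -- `absorb` supplies.
    (signedSum-vanishes (restrict true S) (inv ∘ s⊆s) B⊆′
      (ℕ.≤-antisym (mono _ _ (s⊆s B⊆′))
        (ℕ.≤-trans (mono _ _ (s⊆s (q⊆p∪q B B′)))
          (ℕ.≤-reflexive (absorb {B = true ∷ B} B⊆B′ eq (out⊆ λ x → x)))))
      (≢ ∘ cong (false ∷_)))
  where
  open IsSignedRank S
  B⊆′ = drop-∷-⊆ B⊆B′

-- Sums over lists and their link to sums over supersets.

sumOver : List X → (X → ℤ) → ℤ
sumOver xs f = List.foldr _+_ 0ℤ (List.map f xs)

sumOver-cong : ∀ (xs : List X) {f g : X → ℤ} → (∀ x → f x ≡ g x) → sumOver xs f ≡ sumOver xs g
sumOver-cong []       eq = refl
sumOver-cong (x ∷ xs) eq = cong₂ _+_ (eq x) (sumOver-cong xs eq)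

sumOver-zero : ∀ (xs : List X) {f : X → ℤ} → (∀ x → f x ≡ 0ℤ) → sumOver xs f ≡ 0ℤ
sumOver-zero []       eq = refl
sumOver-zero (x ∷ xs) eq = cong₂ _+_ (eq x) (sumOver-zero xs eq)

sumOver-* : ∀ i (xs : List X) {f : X → ℤ} → i * sumOver xs f ≡ sumOver xs (λ x → i * f x)
sumOver-* i []       = ℤ.*-zeroʳ i
sumOver-* i (x ∷ xs) {f} =
  trans (ℤ.*-distribˡ-+ i (f x) _) (cong (_+_ (i * f x)) (sumOver-* i xs))

sumOver-++ : ∀ (xs ys : List X) {f : X → ℤ} →
             sumOver (xs ++ ys) f ≡ sumOver xs f + sumOver ys f
sumOver-++ []       ys = sym (ℤ.+-identityˡ _)
sumOver-++ (x ∷ xs) ys {f} =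
  trans (cong (_+_ (f x)) (sumOver-++ xs ys)) (sym (ℤ.+-assoc (f x) _ _))

sumOver-map : ∀ (h : X → Y) (xs : List X) {f : Y → ℤ} →
              sumOver (List.map h xs) f ≡ sumOver xs (f ∘ h)
sumOver-map h []       = refl
sumOver-map h (x ∷ xs) {f} = cong (_+_ (f (h x))) (sumOver-map h xs)

sumOver-cartesianProductWith :
  ∀ (h : X → Y → Z) (xs : List X) (ys : List Y) {f : Z → ℤ} →
  sumOver (cartesianProductWith h xs ys) f ≡ sumOver xs λ x → sumOver ys λ y → f (h x y)
sumOver-cartesianProductWith h []       ys = refl
sumOver-cartesianProductWith h (x ∷ xs) ys = trans
  (sumOver-++ (List.map (h x) ys) _)
  (cong₂ _+_ (sumOver-map (h x) ys) (sumOver-cartesianProductWith h xs ys))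

sumOver-filter : ∀ {P : X → Set} (P? : ∀ x → Dec (P x)) (xs : List X) {f : X → ℤ} →
                 sumOver (filter P? xs) f ≡ sumOver xs λ x → does (P? x) ▹ f x
sumOver-filter P? [] = refl
sumOver-filter P? (x ∷ xs) {f} with does (P? x)
... | true  = cong (_+_ (f x)) (sumOver-filter P? xs)
... | false = trans (sumOver-filter P? xs) (sym (ℤ.+-identityˡ _))

-- Separates the first set of a chain from the rest: `p` and `l` guard the inclusions, `q` and `s`
-- the exponents, `i` is the sign of the first set.
sumOver-factor : ∀ p q i (l s : X → Bool) (f : X → ℤ) (xs : List X) →
  sumOver xs (λ x → (p ∧ l x) ▹ (q ∧ s x) ▹ i * f x) ≡
  p ▹ q ▹ i * sumOver xs (λ x → l x ▹ s x ▹ f x)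
sumOver-factor true true i l s f xs = sym (trans (sumOver-* i xs)
  (sumOver-cong xs λ x → trans (*-▹-comm (l x) i _) (cong (l x ▹_) (*-▹-comm (s x) i (f x)))))
sumOver-factor true false i l s f xs = sumOver-zero xs (▹-zero ∘ l)
sumOver-factor false q i l s f xs = sumOver-zero xs λ _ → refl

-- Makes sums above different sets comparable term by term, and connects `Σ⊇` with the enumeration
-- behind `chains`.
Σ⊇-sumOver : ∀ (B : Subset n) (f : Subset n → ℤ) →
             Σ⊇ B f ≡ sumOver (subsets n) λ A → does (B ⊆? A) ▹ f A
Σ⊇-sumOver []          f = sym (ℤ.+-identityʳ (f []))
Σ⊇-sumOver {suc n} (b ∷ B) f = trans (split b)
  (sym (sumOver-cartesianProductWith _∷_ (false ∷ true ∷ []) (subsets n)))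
  where
  split : ∀ b → Σ⊇ (b ∷ B) f ≡
    sumOver (false ∷ true ∷ []) λ a → sumOver (subsets n) λ A → does ((b ∷ B) ⊆? (a ∷ A)) ▹ f (a ∷ A)
  split true  = trans (Σ⊇-sumOver B _) (sym (trans
    (cong₂ _+_ (sumOver-zero (subsets n) λ A → refl) (ℤ.+-identityʳ Σ₁)) (ℤ.+-identityˡ Σ₁)))
    where Σ₁ = sumOver (subsets n) λ A → does (B ⊆? A) ▹ f (true ∷ A)
  split false = cong₂ _+_ (Σ⊇-sumOver B _)
    (trans (Σ⊇-sumOver B _) (sym (ℤ.+-identityʳ _)))

-- Only flats contribute, and a flat containing `C` contains `D`: otherwise `A ∪ D` would be a
-- proper superset of `A` of the same rank.
Σ⊇-invariant : ∀ {ρ : Subset n → ℕ} {ε} → IsSignedRank ρ ε →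
  VanishesOffFlats ρ h → ClosureInvariant ρ (λ B → Σ⊇ B h)
Σ⊇-invariant {n} {h} {ρ} S van {C} {D} C⊆D ρC≡ρD = begin
  Σ⊇ C h                                    ≡⟨ Σ⊇-sumOver C h ⟩
  sumOver (subsets n) (λ A → does (C ⊆? A) ▹ h A) ≡⟨ sumOver-cong (subsets n) same ⟩
  sumOver (subsets n) (λ A → does (D ⊆? A) ▹ h A) ≡⟨ Σ⊇-sumOver D h ⟨
  Σ⊇ D h                                    ∎
  where
  open IsSignedRank S
  open ≡-Reasoning
  same : ∀ A → does (C ⊆? A) ▹ h A ≡ does (D ⊆? A) ▹ h A
  same A with C ⊆? A | D ⊆? A
  ... | yes _   | yes _   = refl
  ... | no  _   | no  _   = refl
  ... | no C⊈A  | yes D⊆A = contradiction (λ {_} x∈C → D⊆A (C⊆D x∈C)) C⊈A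
  ... | yes C⊆A | no D⊈A  = van (p⊆p∪q D) (sym (absorb C⊆D ρC≡ρD C⊆A))
    λ A≡A∪D → D⊈A λ {_} x∈D → subst (_ ∈_) (sym A≡A∪D) (q⊆p∪q A D x∈D)

-- Adding one element, and powers of -1.

[]≔-⊆-∪ : ∀ (A : Subset n) i → A [ i ]≔ true ⊆ A ∪ ⁅ i ⁆
[]≔-⊆-∪ (true  ∷ A) zero here = here
[]≔-⊆-∪ (false ∷ A) zero here = here
[]≔-⊆-∪ (b ∷ A) zero (there x∈A) = there (p⊆p∪q ⊥ x∈A)
[]≔-⊆-∪ (true ∷ A) (suc i) here = here
[]≔-⊆-∪ (b ∷ A) (suc i) (there x∈A) = there ([]≔-⊆-∪ A i x∈A)

⊆-[]≔ : ∀ (A : Subset n) i → A ⊆ A [ i ]≔ true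
⊆-[]≔ (true ∷ A) zero here = here
⊆-[]≔ (b ∷ A) zero (there x∈A) = there x∈A
⊆-[]≔ (b ∷ A) (suc i) here = here
⊆-[]≔ (b ∷ A) (suc i) (there x∈A) = there (⊆-[]≔ A i x∈A)

∣[]≔∣ : ∀ (A : Subset n) i → lookup A i ≡ false → ∣ A [ i ]≔ true ∣ ≡ suc ∣ A ∣
∣[]≔∣ (false ∷ A) zero    eq = refl
∣[]≔∣ (true  ∷ A) (suc i) eq = cong suc (∣[]≔∣ A i eq)
∣[]≔∣ (false ∷ A) (suc i) eq = ∣[]≔∣ A i eq

-1^2+ : ∀ d → -1ℤ ^ suc (suc d) ≡ -1ℤ ^ d
-1^2+ d = trans (sym (ℤ.*-assoc -1ℤ -1ℤ (-1ℤ ^ d))) (ℤ.*-identityˡ _)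

-1^[d+2m] : ∀ d m → -1ℤ ^ (d ℕ.+ (m ℕ.+ m)) ≡ -1ℤ ^ d
-1^[d+2m] d zero    = cong (-1ℤ ^_) (ℕ.+-identityʳ d)
-1^[d+2m] d (suc m) = begin
  -1ℤ ^ (d ℕ.+ (suc m ℕ.+ suc m))       ≡⟨ cong (-1ℤ ^_) (shift d m) ⟩
  -1ℤ ^ suc (suc (d ℕ.+ (m ℕ.+ m)))     ≡⟨ -1^2+ (d ℕ.+ (m ℕ.+ m)) ⟩
  -1ℤ ^ (d ℕ.+ (m ℕ.+ m))               ≡⟨ -1^[d+2m] d m ⟩
  -1ℤ ^ d                               ∎
  where
  open ≡-Reasoning
  shift : ∀ d m → d ℕ.+ (suc m ℕ.+ suc m) ≡ suc (suc (d ℕ.+ (m ℕ.+ m)))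
  shift = ℕ.solve-∀

-- Gives every chain a preceding set, so that the nested sum can start at `⊥`.
⊥-linked : ∀ {k} {As : Vec (Subset n) k} → Linked _⊆_ As → Linked _⊆_ (⊥ ∷ As)
⊥-linked []           = [-]
⊥-linked l@[-]        = ⊥⊆ ∷ l
⊥-linked l@(_ ∷ _)    = ⊥⊆ ∷ l

-- Coefficients of formal sums and products of monomials.

coeff-++ : ∀ {k} (p q : Poly k) m → coeff (p ++ q) m ≡ coeff p m + coeff q m
coeff-++ p q m = begin
  coeff (p ++ q) m         ≡⟨ coeff-sumOver (p ++ q) ⟩
  sumOver (p ++ q) select  ≡⟨ sumOver-++ p q ⟩
  sumOver p select + sumOver q select ≡⟨ cong₂ _+_ (coeff-sumOver p) (coeff-sumOver q) ⟨
  coeff p m + coeff q m    ∎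
  where
  open ≡-Reasoning
  select = λ t → does (≡-dec ℕ._≟_ (proj₂ t) m) ▹ proj₁ t
  coeff-sumOver : ∀ p → coeff p m ≡ sumOver p select
  coeff-sumOver p = sumOver-filter (λ t → ≡-dec ℕ._≟_ (proj₂ t) m) p

coeff-∑ : ∀ {k} (p : X → Poly k) xs m →
          coeff (∑ (List.map p xs)) m ≡ sumOver xs λ x → coeff (p x) m
coeff-∑ p []       m = refl
coeff-∑ p (x ∷ xs) m = trans (coeff-++ (p x) _ m) (cong (_+_ (coeff (p x) m)) (coeff-∑ p xs m))

coeff-monomial : ∀ {k} c (u m : Vec ℕ k) →
                 coeff [ c , u ] m ≡ (does (≡-dec ℕ._≟_ u m) ▹ c)
coeff-monomial c u m with does (≡-dec ℕ._≟_ u m)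
... | true  = ℤ.+-identityʳ c
... | false = refl

infixl 6 _⊕_

_⊕_ : ∀ {k} → Vec ℕ k → Vec ℕ k → Vec ℕ k
_⊕_ = zipWith ℕ._+_

monomial-exponent : ∀ {k} → Fin k → ℕ → Vec ℕ k
monomial-exponent i e = replicate _ 0 [ i ]≔ e

monomial-exponent-⊕ : ∀ {k} (i : Fin k) d e →
  monomial-exponent i d ⊕ monomial-exponent i e ≡ monomial-exponent i (d ℕ.+ e)
monomial-exponent-⊕ zero    d e = cong (d ℕ.+ e ∷_) (zipWith-replicate ℕ._+_ 0 0)
monomial-exponent-⊕ (suc i) d e = cong (0 ∷_) (monomial-exponent-⊕ i d e)

-- An equality of lists, not merely of coefficients, since products of one-term sums have one term.
var-⊗^ : ∀ {k} (i : Fin k) e → var i ⊗^ e ≡ [ 1ℤ , monomial-exponent i e ]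
var-⊗^ i zero    = cong (λ u → [ 1ℤ , u ]) (sym (zero-exponent i))
  where
  zero-exponent : ∀ {k} (i : Fin k) → monomial-exponent i 0 ≡ replicate k 0
  zero-exponent zero    = refl
  zero-exponent (suc i) = cong (0 ∷_) (zero-exponent i)
var-⊗^ i (suc e) rewrite var-⊗^ i e = cong (λ u → [ 1ℤ , u ]) (monomial-exponent-⊕ i 1 e)

const-⊗-var-⊗^ : ∀ {k} c (i : Fin k) e → const c ⊗ var i ⊗^ e ≡ [ c , monomial-exponent i e ]
const-⊗-var-⊗^ c i e rewrite var-⊗^ i e =
  cong₂ (λ c u → [ c , u ]) (ℤ.*-identityʳ c) (zipWith-identityˡ ℕ.+-identityˡ _)

∏-monomials : ∀ {k l} (p : VecF.Vector (Poly k) l) c u → (∀ i → p i ≡ [ c i , u i ]) →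
  ∏ p ≡ [ VecF.foldr _*_ 1ℤ c , VecF.foldr _⊕_ (replicate k 0) u ]
∏-monomials {l = zero}  p c u eq = refl
∏-monomials {l = suc l} p c u eq =
  cong₂ _⊗_ (eq zero) (∏-monomials (p ∘ suc) (c ∘ suc) (u ∘ suc) (eq ∘ suc))

sum-monomial-exponents : ∀ {k} (es : Vec ℕ k) →
  VecF.foldr _⊕_ (replicate k 0) (λ i → monomial-exponent i (lookup es i)) ≡ es
sum-monomial-exponents []       = refl
sum-monomial-exponents (e ∷ es) = trans
  (cong (monomial-exponent zero e ⊕_)
    (trans (foldr-0∷ λ i → monomial-exponent i (lookup es i))
           (cong (0 ∷_) (sum-monomial-exponents es))))
  (cong₂ _∷_ (ℕ.+-identityʳ e) (zipWith-identityˡ ℕ.+-identityˡ es))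
  where
  foldr-0∷ : ∀ {k l} {z : Vec ℕ k} (u : VecF.Vector (Vec ℕ k) l) →
    VecF.foldr _⊕_ (0 ∷ z) (λ i → 0 ∷ u i) ≡ 0 ∷ VecF.foldr _⊕_ z u
  foldr-0∷ {l = zero}  u = refl
  foldr-0∷ {l = suc l} u = cong ((0 ∷ u zero) ⊕_) (foldr-0∷ (u ∘ suc))

-- Parities and signs.

parity : ℕ → Sign.Sign
parity zero    = Sign.+
parity (suc d) = opposite (parity d)

parity-% : ∀ d → (d % 2 ≡ 0 × parity d ≡ Sign.+) ⊎ (d % 2 ≡ 1 × parity d ≡ Sign.-)
parity-% 0 = inj₁ (refl , refl)
parity-% 1 = inj₂ (refl , refl)
parity-% (suc (suc d)) rewrite Sign.opposite-involutive (parity d) = parity-% d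

-- The shift `a` stands for `k * rank`, which all coefficients share.
parity-≡ : ∀ a d d′ → d % 2 ≡ d′ % 2 → parity (a ℕ.+ d) ≡ parity (a ℕ.+ d′)
parity-≡ (suc a) d d′ eq = cong opposite (parity-≡ a d d′ eq)
parity-≡ zero d d′ eq with parity-% d | parity-% d′
... | inj₁ (_ , p) | inj₁ (_ , q) = trans p (sym q)
... | inj₂ (_ , p) | inj₂ (_ , q) = trans p (sym q)
... | inj₁ (p , _) | inj₂ (q , _) with () ← trans (sym p) (trans eq q)
... | inj₂ (p , _) | inj₁ (q , _) with () ← trans (sym p) (trans eq q)

parity-≢ : ∀ a d d′ → d % 2 ≢ d′ % 2 →
           parity (a ℕ.+ d) ≡ opposite (parity (a ℕ.+ d′))
parity-≢ (suc a) d d′ neq = cong opposite (parity-≢ a d d′ neq)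
parity-≢ zero d d′ neq with parity-% d | parity-% d′
... | inj₁ (_ , p) | inj₂ (_ , q) = trans p (cong opposite (sym q))
... | inj₂ (_ , p) | inj₁ (_ , q) = trans p (cong opposite (sym q))
... | inj₁ (p , _) | inj₁ (q , _) = contradiction (trans p (sym q)) neq
... | inj₂ (p , _) | inj₂ (q , _) = contradiction (trans p (sym q)) neq

-- Each step moves one factor -1 from the power onto `c`. Zero is excluded because `sign 0ℤ` is
-- `Sign.+`.
sign≡parity : ∀ d c → c ≢ 0ℤ → 0ℤ ℤ.≤ -1ℤ ^ d * c → sign c ≡ parity d
sign≡parity zero c c≢0 0≤c with ℤ.*-identityˡ c
... | eq with +≤+ _ ← subst (0ℤ ℤ.≤_) eq 0≤c = refl
sign≡parity (suc d) c c≢0 0≤c = begin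
  sign c                  ≡⟨ sign-neg c c≢0 ⟩
  opposite (sign (- c))   ≡⟨ cong opposite (sign≡parity d (- c) (c≢0 ∘ ℤ.neg-injective)
                               (subst (0ℤ ℤ.≤_) move 0≤c)) ⟩
  opposite (parity d)     ∎
  where
  open ≡-Reasoning
  sign-neg : ∀ c → c ≢ 0ℤ → sign c ≡ opposite (sign (- c))
  sign-neg (+ zero)  c≢0 = contradiction refl c≢0
  sign-neg (+ suc _) _   = refl
  sign-neg -[1+ _ ]  _   = refl
  move : -1ℤ ^ suc d * c ≡ -1ℤ ^ d * - c
  move = begin
    -1ℤ * -1ℤ ^ d * c  ≡⟨ cong (_* c) (ℤ.-1*i≡-i (-1ℤ ^ d)) ⟩
    - -1ℤ ^ d * c      ≡⟨ ℤ.neg-distribˡ-* (-1ℤ ^ d) c ⟨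
    - (-1ℤ ^ d * c)    ≡⟨ ℤ.neg-distribʳ-* (-1ℤ ^ d) c ⟩
    -1ℤ ^ d * - c      ∎

-- Nonnegativity of the nested chain sums of a matroid.

module _ {n} (M : Matroid n) where
  open Matroid M

  ε : Subset n → ℤ
  ε A = -1ℤ ^ (∣ A ∣ ℕ.+ rk A)

  rk-[]≔ : ∀ A i → rk (A [ i ]≔ true) ≤ suc (rk A)
  rk-[]≔ A i = begin
    rk (A [ i ]≔ true)                   ≤⟨ rk-monotone _ _ ([]≔-⊆-∪ A i) ⟩
    rk (A ∪ ⁅ i ⁆)                       ≤⟨ ℕ.m≤m+n _ _ ⟩
    rk (A ∪ ⁅ i ⁆) ℕ.+ rk (A ∩ ⁅ i ⁆)    ≤⟨ rk-submodular A ⁅ i ⁆ ⟩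
    rk A ℕ.+ rk ⁅ i ⁆                    ≤⟨ ℕ.+-monoʳ-≤ (rk A) (rk-bounded ⁅ i ⁆) ⟩
    rk A ℕ.+ ∣ ⁅ i ⁆ ∣                   ≡⟨ cong (rk A ℕ.+_) (∣⁅x⁆∣≡1 i) ⟩
    rk A ℕ.+ 1                           ≡⟨ ℕ.+-comm (rk A) 1 ⟩
    suc (rk A)                           ∎
    where open ℕ.≤-Reasoning

  -- A new element raises the cardinality by one and the rank by zero or one, so the exponent of -1
  -- grows by one or by two.
  rk-signed : IsSignedRank rk ε
  rk-signed = record
    { mono       = rk-monotone
    ; submodular = rk-submodular
    ; flip       = λ A i A∌i eq →
        trans (cong₂ (λ a r → -1ℤ ^ (a ℕ.+ r)) (∣[]≔∣ A i A∌i) eq) (ℤ.-1*i≡-i (ε A))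
    ; keep       = λ A i A∌i neq →
        trans (cong₂ (λ a r → -1ℤ ^ (a ℕ.+ r)) (∣[]≔∣ A i A∌i)
                (ℕ.≤-antisym (rk-[]≔ A i)
                  (ℕ.≤∧≢⇒< (rk-monotone A _ (⊆-[]≔ A i)) (neq ∘ sym))))
          (trans (cong (λ x → -1ℤ ^ suc x) (ℕ.+-suc ∣ A ∣ (rk A))) (-1^2+ (∣ A ∣ ℕ.+ rk A)))
    }

  corank : Subset n → ℕ
  corank A = rank ∸ rk A

  -- The nested sum over chains of coranks ms, as a function of the preceding set B.
  chainSum : ∀ {k} → Vec ℕ k → Subset n → ℤ
  chainSum []       B = 1ℤ
  chainSum (m ∷ ms) B = Σ⊇ B λ A → ε A * ((corank A ℕ.≡ᵇ m) ▹ chainSum ms A)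

  -- Each further sum exchanges the alternatives. In the first, `signedSum-nonneg` and
  -- `signedSum-vanishes` apply, as the corank guard depends only on rank; in the second, the new
  -- factor `ε A` makes every term nonnegative and `Σ⊇-invariant` applies.
  chainSum-alternates : ∀ {k} (ms : Vec ℕ k) →
    (ClosureInvariant rk (chainSum ms) × (∀ B → 0ℤ ℤ.≤ chainSum ms B)) ⊎
    (VanishesOffFlats rk (chainSum ms) × (∀ B → 0ℤ ℤ.≤ ε B * chainSum ms B))
  chainSum-alternates [] = inj₁ ((λ _ _ → refl) , λ _ → +≤+ z≤n)
  chainSum-alternates (m ∷ ms) with chainSum-alternates ms
  ... | inj₁ (inv , 0≤V) = inj₂
    ( signedSum-vanishes rk-signed inv′
    , signedSum-nonneg rk-signed inv′ λ A → ▹-nonneg (corank A ℕ.≡ᵇ m) (0≤V A))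
    where
    inv′ : ClosureInvariant rk (λ A → (corank A ℕ.≡ᵇ m) ▹ chainSum ms A)
    inv′ A⊆B eq = cong₂ (λ r x → ((rank ∸ r) ℕ.≡ᵇ m) ▹ x) eq (inv A⊆B eq)
  ... | inj₂ (van , 0≤εV) = inj₁
    ( Σ⊇-invariant rk-signed van′
    , λ B → Σ⊇-nonneg B λ A → subst (0ℤ ℤ.≤_) (sym (*-▹-comm (corank A ℕ.≡ᵇ m) (ε A) _))
        (▹-nonneg (corank A ℕ.≡ᵇ m) (0≤εV A)))
    where
    van′ : VanishesOffFlats rk (λ A → ε A * ((corank A ℕ.≡ᵇ m) ▹ chainSum ms A))
    van′ {A} A⊆B eq ≢ = trans
      (cong (ε A *_) (trans (cong ((corank A ℕ.≡ᵇ m) ▹_) (van A⊆B eq ≢)) (▹-zero (corank A ℕ.≡ᵇ m))))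
      (ℤ.*-zeroʳ (ε A))

  ∣⊥∣+rk⊥ : ∣ ⊥ {n} ∣ ℕ.+ rk ⊥ ≡ 0
  ∣⊥∣+rk⊥ = cong₂ ℕ._+_ (∣⊥∣≡0 n)
    (ℕ.n≤0⇒n≡0 (ℕ.≤-trans (rk-bounded ⊥) (ℕ.≤-reflexive (∣⊥∣≡0 n))))

  -- Both alternatives agree at `⊥`, where `ε` equals 1.
  chainSum-nonneg : ∀ {k} (ms : Vec ℕ k) → 0ℤ ℤ.≤ chainSum ms ⊥
  chainSum-nonneg ms with chainSum-alternates ms
  ... | inj₁ (_ , 0≤V)  = 0≤V ⊥
  ... | inj₂ (_ , 0≤εV) = subst (0ℤ ℤ.≤_)
    (trans (cong (λ x → -1ℤ ^ x * chainSum ms ⊥) ∣⊥∣+rk⊥) (ℤ.*-identityˡ _)) (0≤εV ⊥)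

  -- Coefficients of the chain polynomial as signed chain sums.

  weight : ∀ {k} → Vec (Subset n) k → ℤ
  weight As = VecF.foldr _*_ 1ℤ λ i → -1ℤ ^ ∣ lookup As i ∣

  expVec : ∀ {k} → Vec (Subset n) k → Vec ℕ k
  expVec = Vec.map corank

  -- At `⊥` this is the coefficient of `ms` in the chain polynomial; a general `B` allows recursion
  -- along the chain.
  coefficientAbove : ∀ {k} → Vec ℕ k → Subset n → ℤ
  coefficientAbove {k} ms B = sumOver (tuples (subsets n) k) λ As →
    does (linked? _⊆?_ (B ∷ As)) ▹ does (≡-dec ℕ._≟_ (expVec As) ms) ▹ weight As

  coefficientAbove-∷ : ∀ {k} m (ms : Vec ℕ k) B → coefficientAbove (m ∷ ms) B ≡
    Σ⊇ B λ A → (corank A ℕ.≡ᵇ m) ▹ (-1ℤ ^ ∣ A ∣ * coefficientAbove ms A)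
  coefficientAbove-∷ {k} m ms B = begin
    coefficientAbove (m ∷ ms) B
      ≡⟨ sumOver-cartesianProductWith _∷_ (subsets n) (tuples (subsets n) k) ⟩
    sumOver (subsets n) (λ A → sumOver (tuples (subsets n) k) λ As →
      does (linked? _⊆?_ (B ∷ A ∷ As)) ▹
      does (≡-dec ℕ._≟_ (expVec (A ∷ As)) (m ∷ ms)) ▹ weight (A ∷ As))
      -- On nonempty vectors both decisions compute to conjunctions, the second headed by
      -- `corank A ℕ.≡ᵇ m`, which is the form `sumOver-factor` expects.
      ≡⟨ sumOver-cong (subsets n) (λ A → sumOver-factor (does (B ⊆? A)) (corank A ℕ.≡ᵇ m)
           (-1ℤ ^ ∣ A ∣) (λ As → does (linked? _⊆?_ (A ∷ As)))
           (λ As → does (≡-dec ℕ._≟_ (expVec As) ms)) weight (tuples (subsets n) k)) ⟩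
    sumOver (subsets n) (λ A → does (B ⊆? A) ▹ (corank A ℕ.≡ᵇ m) ▹ (-1ℤ ^ ∣ A ∣ * coefficientAbove ms A))
      ≡⟨ Σ⊇-sumOver B _ ⟨
    Σ⊇ B (λ A → (corank A ℕ.≡ᵇ m) ▹ (-1ℤ ^ ∣ A ∣ * coefficientAbove ms A)) ∎
    where open ≡-Reasoning

  -- The two sides differ by the signs of the ranks along a chain. Those ranks add up to `k * rank`
  -- minus the total degree, which has the parity of the sum of the two.
  chainSum≡signed-coefficient : ∀ {k} (ms : Vec ℕ k) B →
    chainSum ms B ≡ -1ℤ ^ (k ℕ.* rank ℕ.+ totalDegree ms) * coefficientAbove ms B
  chainSum≡signed-coefficient []       B = refl
  chainSum≡signed-coefficient {suc k} (m ∷ ms) B = trans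
    (Σ⊇-* κ B λ A _ → scaled A)
    (cong (κ *_) (sym (coefficientAbove-∷ m ms B)))
    where
    open ≡-Reasoning
    s = totalDegree ms
    κ = -1ℤ ^ (suc k ℕ.* rank ℕ.+ (m ℕ.+ s))
    -- With `rank` written as `m + r`, the exponents differ by `m + m`, which a power of -1 ignores.
    exponents : ∀ m r kr s a →
      ((m ℕ.+ r ℕ.+ kr) ℕ.+ (m ℕ.+ s)) ℕ.+ a ≡ ((a ℕ.+ r) ℕ.+ (kr ℕ.+ s)) ℕ.+ (m ℕ.+ m)
    exponents = ℕ.solve-∀
    signs : ∀ A → corank A ≡ m →
      ε A * -1ℤ ^ (k ℕ.* rank ℕ.+ s) ≡ κ * -1ℤ ^ ∣ A ∣
    signs A refl = begin
      ε A * -1ℤ ^ (k ℕ.* rank ℕ.+ s)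
        ≡⟨ ℤ.^-distribˡ-+-* -1ℤ (∣ A ∣ ℕ.+ rk A) _ ⟨
      -1ℤ ^ ((∣ A ∣ ℕ.+ rk A) ℕ.+ (k ℕ.* rank ℕ.+ s))
        ≡⟨ -1^[d+2m] ((∣ A ∣ ℕ.+ rk A) ℕ.+ (k ℕ.* rank ℕ.+ s)) m ⟨
      -1ℤ ^ ((∣ A ∣ ℕ.+ rk A) ℕ.+ (k ℕ.* rank ℕ.+ s) ℕ.+ (m ℕ.+ m))
        ≡⟨ cong (-1ℤ ^_) (exponents m (rk A) (k ℕ.* rank) s ∣ A ∣) ⟨
      -1ℤ ^ ((m ℕ.+ rk A ℕ.+ k ℕ.* rank) ℕ.+ (m ℕ.+ s) ℕ.+ ∣ A ∣)
        ≡⟨ cong (λ r → -1ℤ ^ ((r ℕ.+ k ℕ.* rank) ℕ.+ (m ℕ.+ s) ℕ.+ ∣ A ∣))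
             (ℕ.m∸n+n≡m (rk-monotone A ⊤ ⊆⊤)) ⟩
      -1ℤ ^ ((suc k ℕ.* rank ℕ.+ (m ℕ.+ s)) ℕ.+ ∣ A ∣)
        ≡⟨ ℤ.^-distribˡ-+-* -1ℤ (suc k ℕ.* rank ℕ.+ (m ℕ.+ s)) ∣ A ∣ ⟩
      κ * -1ℤ ^ ∣ A ∣ ∎
    scaled : ∀ A → ε A * ((corank A ℕ.≡ᵇ m) ▹ chainSum ms A) ≡
      κ * ((corank A ℕ.≡ᵇ m) ▹ -1ℤ ^ ∣ A ∣ * coefficientAbove ms A)
    scaled A with corank A ℕ.≡ᵇ m | ℕ.≡ᵇ⇒≡ (corank A) m
    ... | false | _  = trans (ℤ.*-zeroʳ (ε A)) (sym (ℤ.*-zeroʳ κ))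
    ... | true  | eq = begin
      ε A * chainSum ms A
        ≡⟨ cong (ε A *_) (chainSum≡signed-coefficient ms A) ⟩
      ε A * (-1ℤ ^ (k ℕ.* rank ℕ.+ s) * coefficientAbove ms A)
        ≡⟨ ℤ.*-assoc (ε A) _ _ ⟨
      ε A * -1ℤ ^ (k ℕ.* rank ℕ.+ s) * coefficientAbove ms A
        ≡⟨ cong (_* coefficientAbove ms A) (signs A (eq _)) ⟩
      κ * -1ℤ ^ ∣ A ∣ * coefficientAbove ms A
        ≡⟨ ℤ.*-assoc κ _ _ ⟩
      κ * (-1ℤ ^ ∣ A ∣ * coefficientAbove ms A) ∎

  -- Definitionally the summand local to `χ`, named here so that it can be rewritten.
  chainTerm : ∀ {k} → Vec (Subset n) k → Poly k
  chainTerm As = ∏ λ i → const (-1ℤ ^ ∣ lookup As i ∣) ⊗ var i ⊗^ corank (lookup As i)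

  chainTerm-monomial : ∀ {k} (As : Vec (Subset n) k) → chainTerm As ≡ [ weight As , expVec As ]
  chainTerm-monomial As = trans
    (∏-monomials _ (λ i → -1ℤ ^ ∣ lookup As i ∣) (λ i → monomial-exponent i (lookup (expVec As) i))
      λ i → trans (const-⊗-var-⊗^ _ i _)
        (cong (λ e → [ -1ℤ ^ ∣ lookup As i ∣ , monomial-exponent i e ]) (sym (lookup-map i corank As))))
    (cong (λ u → [ weight As , u ]) (sum-monomial-exponents (expVec As)))

  coeff-χ : ∀ k (m : Vec ℕ k) → coeff (χ M k) m ≡ coefficientAbove m ⊥
  coeff-χ k m = begin
    coeff (χ M k) m
      ≡⟨ coeff-∑ chainTerm (chains n k) m ⟩
    sumOver (chains n k) (λ As → coeff (chainTerm As) m)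
      ≡⟨ sumOver-cong (chains n k) (λ As → trans (cong (λ p → coeff p m) (chainTerm-monomial As))
           (coeff-monomial (weight As) (expVec As) m)) ⟩
    sumOver (chains n k) (λ As → does (≡-dec ℕ._≟_ (expVec As) m) ▹ weight As)
      ≡⟨ sumOver-filter (linked? _⊆?_) (tuples (subsets n) k) ⟩
    sumOver (tuples (subsets n) k) (λ As →
      does (linked? _⊆?_ As) ▹ does (≡-dec ℕ._≟_ (expVec As) m) ▹ weight As)
      ≡⟨ sumOver-cong (tuples (subsets n) k) (λ As →
           cong (_▹ does (≡-dec ℕ._≟_ (expVec As) m) ▹ weight As)
             (does-⇔ (mk⇔ ⊥-linked Linked.tail) (linked? _⊆?_ As) (linked? _⊆?_ (⊥ ∷ As)))) ⟩
    coefficientAbove m ⊥ ∎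
    where open ≡-Reasoning

  sign-coeff-χ : ∀ k (m : Vec ℕ k) → coeff (χ M k) m ≢ 0ℤ →
    sign (coeff (χ M k) m) ≡ parity (k ℕ.* rank ℕ.+ totalDegree m)
  sign-coeff-χ k m c≢0 = sign≡parity (k ℕ.* rank ℕ.+ totalDegree m) (coeff (χ M k) m) c≢0
    (subst (0ℤ ℤ.≤_)
      (trans (chainSum≡signed-coefficient m ⊥)
        (cong (-1ℤ ^ (k ℕ.* rank ℕ.+ totalDegree m) *_) (sym (coeff-χ k m))))
      (chainSum-nonneg m))

corollary1p8 : ∀ {n : ℕ} (M : Matroid n) (k : ℕ) → 1 ≤ k →
    ∀ (m m′ : Vec ℕ k) → coeff (χ M k) m ≢ 0ℤ → coeff (χ M k) m′ ≢ 0ℤ →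
    (totalDegree m % 2 ≡ totalDegree m′ % 2 →
    sign (coeff (χ M k) m) ≡ sign (coeff (χ M k) m′))
    × (totalDegree m % 2 ≢ totalDegree m′ % 2 →
    sign (coeff (χ M k) m) ≡ opposite (sign (coeff (χ M k) m′)))
corollary1p8 M k _ m m′ c≢0 c′≢0 =
    (λ eq → trans (sign-coeff-χ M k m c≢0)
      (trans (parity-≡ shift _ _ eq) (sym (sign-coeff-χ M k m′ c′≢0))))
  , (λ neq → trans (sign-coeff-χ M k m c≢0)
      (trans (parity-≢ shift _ _ neq) (cong opposite (sym (sign-coeff-χ M k m′ c′≢0)))))
  where shift = k ℕ.* Matroid.rank M
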